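{- Let $G$ be an affine game. Then $G$ is invertible if and only if $G$ is a Conway game. Moreover, if $G$ is a Conway game, then $G+(-G)=0$, where $-G$ is the conjugate of $G$.
   Context: Affine games are defined recursively. There are two games without options, denoted $\infty$ and $\overline{\infty}$ (terminating games). Every other affine game is a form $G=\{G^{\mathcal L}\mid G^{\mathcal R}\}$, where $G^{\mathcal L}$ (Left options) and $G^{\mathcal R}$ (Right options) are non-empty finite sets of previously constructed affine games. Let $\mathbb A$ be the set of all affine games. The game $0$ is $\{\overline\infty\mid\infty\}$. The followers of $G$ are $G$ itself and all games reachable from $G$ by a finite sequence of (not necessarily alternating) moves to options. Disjunctive sum: $G+H$ is undefined if one of $G,H$ is the form $\infty$ and the other is $\overline\infty$; it is $\infty$ if one is $\infty$ and the other is not $\overline\infty$; it is $\overline\infty$ if one is $\overline\infty$ and the other is not $\infty$; otherwise $G+H=\{G^{\mathcal L}+H,\,G+H^{\mathcal L}\mid G^{\mathcal R}+H,\,G+H^{\mathcal R}\}$. Outcomes: $o^L(G)=\mathbf L$ if $G=\infty$ or some $G^L\in G^{\mathcal L}$ has $o^R(G^L)=\mathbf L$, and $o^L(G)=\mathbf R$ otherwise; $o^R(G)=\mathbf R$ if $G=\overline\infty$ or some $G^R\in G^{\mathcal R}$ has $o^L(G^R)=\mathbf R$, and $o^R(G)=\mathbf L$ otherwise; $o(G)=(o^L(G),o^R(G))$. Equality of games: $G=H$ iff $o(G+X)=o(H+X)$ for all $X\in\mathbb A\setminus\{\infty,\overline\infty\}$. Conjugate: $-\infty=\overline\infty$, $-\overline\infty=\infty$,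 and otherwise $-G=\{ -G^{\mathcal R}\mid -G^{\mathcal L}\}$ (conjugating each option). $G$ is invertible if there is an affine game $H$ with $G+H$ defined and $G+H=0$ (equality of games). A game is a check if $\infty$ is one of its Left options or $\overline\infty$ is one of its Right options. A Conway form is an affine game form that is neither $\infty$ nor $\overline\infty$ and has no checks among its followers. A Conway game is an affine game equal (as a game) to some Conway form. -}

module Defs where

open import Data.Bool using (if_then_else_)
open import Data.Empty using (⊥; ⊥-elim-irr)
open import Data.Fin using (Fin)
open import Data.Fin.Properties using (any?)
open import Data.Nat using (suc)
open import Data.Product using (Σ-syntax; ∃-syntax; _×_; _,_; proj₁; proj₂)
open import Data.Sum using (_⊎_)
open import Data.Vec.Functional using (Vector; _++_)
open import Function using (_∘_)
open import Relation.Binary.Construct.Closure.ReflexiveTransitive using (Star)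
open import Relation.Binary.Definitions using (DecidableEquality)
open import Relation.Binary.PropositionalEquality using (_≡_; _≢_; refl)
open import Relation.Nullary using (¬_; yes; no; does)

-- A non-empty finite set of options is presented as a family over Fin (suc n);
-- order and repetition of options affect neither outcomes nor followers.
data Game : Set where
  ∞     : Game
  ∞̄     : Game
  ⟨_∣_⟩ : ∀ {m n} → Vector Game (suc m) → Vector Game (suc n) → Game

𝟘 : Game
𝟘 = ⟨ (λ (_ : Fin 1) → ∞̄) ∣ (λ (_ : Fin 1) → ∞) ⟩

NonTerminal : Game → Set
NonTerminal G = G ≢ ∞ × G ≢ ∞̄

Summable : Game → Game → Set
Summable G H = ¬ (G ≡ ∞ × H ≡ ∞̄) × ¬ (G ≡ ∞̄ × H ≡ ∞)

summableˡ : ∀ {G} H → NonTerminal G → Summable G H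
summableˡ H (G≢∞ , G≢∞̄) = G≢∞ ∘ proj₁ , G≢∞̄ ∘ proj₁

summableʳ : ∀ G {H} → NonTerminal H → Summable G H
summableʳ G (H≢∞ , H≢∞̄) = H≢∞̄ ∘ proj₂ , H≢∞ ∘ proj₂

⟨∣⟩-nonTerminal : ∀ {m n} {L : Vector Game (suc m)} {R : Vector Game (suc n)} →
                  NonTerminal ⟨ L ∣ R ⟩
⟨∣⟩-nonTerminal = (λ ()) , (λ ())

infixl 6 _+_[_]

_+_[_] : (G H : Game) → .(Summable G H) → Game
∞ + ∞ [ _ ] = ∞
∞ + ∞̄ [ d ] = ⊥-elim-irr (proj₁ d (refl , refl))
∞ + ⟨ _ ∣ _ ⟩ [ _ ] = ∞
∞̄ + ∞ [ d ] = ⊥-elim-irr (proj₂ d (refl , refl))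
∞̄ + ∞̄ [ _ ] = ∞̄
∞̄ + ⟨ _ ∣ _ ⟩ [ _ ] = ∞̄
⟨ _ ∣ _ ⟩ + ∞ [ _ ] = ∞
⟨ _ ∣ _ ⟩ + ∞̄ [ _ ] = ∞̄
G@(⟨ Gᴸ ∣ Gᴿ ⟩) + H@(⟨ Hᴸ ∣ Hᴿ ⟩) [ _ ] =
  ⟨ (λ i → Gᴸ i + H [ summableʳ (Gᴸ i) ⟨∣⟩-nonTerminal ])
    ++ (λ j → G + Hᴸ j [ summableˡ (Hᴸ j) ⟨∣⟩-nonTerminal ])
  ∣ (λ i → Gᴿ i + H [ summableʳ (Gᴿ i) ⟨∣⟩-nonTerminal ])
    ++ (λ j → G + Hᴿ j [ summableˡ (Hᴿ j) ⟨∣⟩-nonTerminal ])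
  ⟩

infix 8 -_

-_ : Game → Game
- ∞ = ∞̄
- ∞̄ = ∞
- ⟨ Gᴸ ∣ Gᴿ ⟩ = ⟨ (λ j → - Gᴿ j) ∣ (λ i → - Gᴸ i) ⟩

data Player : Set where
  𝐋 𝐑 : Player

_≟_ : DecidableEquality Player
𝐋 ≟ 𝐋 = yes refl
𝐋 ≟ 𝐑 = no λ ()
𝐑 ≟ 𝐋 = no λ ()
𝐑 ≟ 𝐑 = yes refl

mutual
  oᴸ : Game → Player
  oᴸ ∞ = 𝐋
  oᴸ ∞̄ = 𝐑
  oᴸ ⟨ Gᴸ ∣ _ ⟩ = if does (any? λ i → oᴿ (Gᴸ i) ≟ 𝐋) then 𝐋 else 𝐑

  oᴿ : Game → Player
  oᴿ ∞ = 𝐋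
  oᴿ ∞̄ = 𝐑
  oᴿ ⟨ _ ∣ Gᴿ ⟩ = if does (any? λ j → oᴸ (Gᴿ j) ≟ 𝐑) then 𝐑 else 𝐋

o : Game → Player × Player
o G = oᴸ G , oᴿ G

infix 4 _≐_

_≐_ : Game → Game → Set
G ≐ H = ∀ X (x : NonTerminal X) →
        o (G + X [ summableʳ G x ]) ≡ o (H + X [ summableʳ H x ])

Invertible : Game → Set
Invertible G = ∃[ H ] Σ[ d ∈ Summable G H ] G + H [ d ] ≐ 𝟘

infix 4 _∈ᴸ_ _∈ᴿ_

_∈ᴸ_ : Game → Game → Set
H ∈ᴸ ∞ = ⊥
H ∈ᴸ ∞̄ = ⊥
H ∈ᴸ ⟨ Gᴸ ∣ _ ⟩ = ∃[ i ] Gᴸ i ≡ H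

_∈ᴿ_ : Game → Game → Set
H ∈ᴿ ∞ = ⊥
H ∈ᴿ ∞̄ = ⊥
H ∈ᴿ ⟨ _ ∣ Gᴿ ⟩ = ∃[ j ] Gᴿ j ≡ H

_⟶_ : Game → Game → Set
G ⟶ H = H ∈ᴸ G ⊎ H ∈ᴿ G

_IsFollowerOf_ : Game → Game → Set
H IsFollowerOf G = Star _⟶_ G H

Check : Game → Set
Check G = ∞ ∈ᴸ G ⊎ ∞̄ ∈ᴿ G

ConwayForm : Game → Set
ConwayForm G = NonTerminal G × (∀ H → H IsFollowerOf G → ¬ Check H)

ConwayGame : Game → Set
ConwayGame G = ∃[ K ] ConwayForm K × G ≐ K

{-# OPTIONS --safe #-}

-- A player who wins A moving second and B in some role also wins A + B in that role,
-- by replying locally; hence A = 0 exactly when A is a second-player win. This makes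
-- mirroring prove K − K = 0 for Conway forms: mirroring fails only against a check.
--
-- Conversely let G + H = 0, so that E ≤ G reads as "Left moving first loses E + H".
-- Bypass the reversible options of G and of H. A remaining Left option E of G must
-- then be answered by a remaining Right option F of H, and F by a remaining Left
-- option E′ of G, so that E + F ≤ 0 ≤ E′ + F and E ≤ E′. A maximal E therefore has
-- E + F = 0; it is a smaller invertible game, equal to a Conway form by induction.
-- These Conway forms, for both players, are the options of a Conway form equal to G.
module Submission where

open import Algebra.Bundles using (CommutativeSemigroup)
import Algebra.Properties.CommutativeSemigroup as CommutativeSemigroupProperties
open import Data.Empty using (⊥-elim; ⊥-elim-irr)
open import Data.Fin using (Fin; _↑ˡ_; _↑ʳ_; splitAt)
open import Data.Fin.Induction using (spo-wellFounded)
open import Data.Fin.Properties using (any?)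
open import Data.List using (List; []; _∷_; _++_; concat; length; lookup; tabulate)
open import Data.List.Membership.Propositional using (_∈_)
open import Data.List.Membership.Propositional.Properties
  using (∈-++⁺ˡ; ∈-++⁺ʳ; ∈-++⁻; ∈-concat⁺′; ∈-concat⁻′; ∈-tabulate⁺; ∈-tabulate⁻)
open import Data.List.Relation.Unary.Any using (here; there; index)
open import Data.List.Relation.Unary.Any.Properties using (lookup-index)
open import Data.Nat using (suc)
open import Data.Product using (_×_; Σ-syntax; ∃; _,_; proj₁; proj₂)
open import Data.Sum using (_⊎_; inj₁; inj₂; fromInj₁; swap)
open import Data.Vec.Functional.Properties using (lookup-++ˡ; lookup-++ʳ)
open import Function.Bundles using (_⇔_; mk⇔)
open import Induction.WellFounded using (Acc; acc; WellFounded)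
open import Relation.Binary.Construct.Closure.ReflexiveTransitive using (ε; _◅_)
open import Relation.Binary.PropositionalEquality
  using (_≡_; _≢_; refl; sym; trans; cong; cong₂; subst; isEquivalence; resp₂)
open import Relation.Nullary using (¬_; Dec; yes; no)
open import Relation.Nullary.Decidable using (dec-true; dec-false; _×-dec_; ¬?)
open import Defs renaming (⟨∣⟩-nonTerminal to nt)

-- Players, terminal games and options.

-- A relation instead of a function: matching on it fixes both players at once, so nearly every
-- argument is given once for `p` against `s` and covers Left and Right alike.
data _⇄_ : Player → Player → Set where
  𝐋⇄𝐑 : 𝐋 ⇄ 𝐑
  𝐑⇄𝐋 : 𝐑 ⇄ 𝐋

⇄-sym : ∀ {p s} → p ⇄ s → s ⇄ p
⇄-sym 𝐋⇄𝐑 = 𝐑⇄𝐋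
⇄-sym 𝐑⇄𝐋 = 𝐋⇄𝐑

⇄⇒≢ : ∀ {p s} → p ⇄ s → p ≢ s
⇄⇒≢ 𝐋⇄𝐑 ()
⇄⇒≢ 𝐑⇄𝐋 ()

opponent : ∀ p → ∃ (p ⇄_)
opponent 𝐋 = 𝐑 , 𝐋⇄𝐑
opponent 𝐑 = 𝐋 , 𝐑⇄𝐋

terminal : Player → Game
terminal 𝐋 = ∞
terminal 𝐑 = ∞̄

terminal-distinct : ∀ {p s} → p ⇄ s → terminal p ≢ terminal s
terminal-distinct 𝐋⇄𝐑 ()
terminal-distinct 𝐑⇄𝐋 ()

nonTerminal≢ : ∀ {A} p → NonTerminal A → A ≢ terminal p
nonTerminal≢ 𝐋 = proj₁
nonTerminal≢ 𝐑 = proj₂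

data View (p s : Player) : Game → Set where
  mine    : View p s (terminal p)
  theirs  : View p s (terminal s)
  neither : ∀ {A} → NonTerminal A → View p s A

view : ∀ {p s} → p ⇄ s → ∀ A → View p s A
view 𝐋⇄𝐑 ∞         = mine
view 𝐋⇄𝐑 ∞̄         = theirs
view 𝐋⇄𝐑 ⟨ _ ∣ _ ⟩ = neither nt
view 𝐑⇄𝐋 ∞         = theirs
view 𝐑⇄𝐋 ∞̄         = mine
view 𝐑⇄𝐋 ⟨ _ ∣ _ ⟩ = neither nt

infix 4 _∈[_]_

data _∈[_]_ : Game → Player → Game → Set where
  left  : ∀ {m n L R} i → L i ∈[ 𝐋 ] ⟨_∣_⟩ {m} {n} L R
  right : ∀ {m n L R} j → R j ∈[ 𝐑 ] ⟨_∣_⟩ {m} {n} L R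

∈ᴸ⇒∈ : ∀ {A B} → B ∈ᴸ A → B ∈[ 𝐋 ] A
∈ᴸ⇒∈ {⟨ _ ∣ _ ⟩} (i , refl) = left i

∈ᴿ⇒∈ : ∀ {A B} → B ∈ᴿ A → B ∈[ 𝐑 ] A
∈ᴿ⇒∈ {⟨ _ ∣ _ ⟩} (j , refl) = right j

∈⇒∈ᴸ : ∀ {A B} → B ∈[ 𝐋 ] A → B ∈ᴸ A
∈⇒∈ᴸ (left i) = i , refl

∈⇒∈ᴿ : ∀ {A B} → B ∈[ 𝐑 ] A → B ∈ᴿ A
∈⇒∈ᴿ (right j) = j , refl

option⇒⟶ : ∀ {p A B} → B ∈[ p ] A → A ⟶ B
option⇒⟶ (left i)  = inj₁ (i , refl)
option⇒⟶ (right j) = inj₂ (j , refl)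

¬option-terminal : ∀ {p B} q → ¬ B ∈[ p ] terminal q
¬option-terminal 𝐋 ()
¬option-terminal 𝐑 ()

-- Winning strategies, determinacy and outcomes.

mutual
  data First (p : Player) (A : Game) : Set where
    won  : A ≡ terminal p → First p A
    move : ∀ {B} → B ∈[ p ] A → Second p B → First p A

  data Second (p : Player) (A : Game) : Set where
    won   : A ≡ terminal p → Second p A
    -- Without `NonTerminal A`, the opponent's terminal game, which has no options, would be won
    -- vacuously.
    reply : NonTerminal A → (∀ {s B} → p ⇄ s → B ∈[ s ] A → First p B) → Second p A

first-second-exclusive : ∀ {p s A} → p ⇄ s → First p A → ¬ Second s A
first-second-exclusive ps (won refl) (won e) = terminal-distinct ps e
first-second-exclusive {p} ps (won e) (reply a _) = nonTerminal≢ p a e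
first-second-exclusive {s = s} ps (move m _) (won refl) = ¬option-terminal s m
first-second-exclusive ps (move m d) (reply _ f) =
  first-second-exclusive (⇄-sym ps) (f (⇄-sym ps) m) d

¬first-terminal : ∀ {p s} → p ⇄ s → ¬ First p (terminal s)
¬first-terminal ps f = first-second-exclusive ps f (won refl)

¬second-terminal : ∀ {p s} → p ⇄ s → ¬ Second p (terminal s)
¬second-terminal ps = first-second-exclusive (⇄-sym ps) (won refl)

first-reply : ∀ {p s A B} → p ⇄ s → Second p A → B ∈[ s ] A → First p B
first-reply {p} ps (won refl)  m = ⊥-elim (¬option-terminal p m)
first-reply     ps (reply _ f) m = f ps m

winning-option : ∀ {p A} → NonTerminal A → First p A → ∃ λ B → B ∈[ p ] A × Second p B
winning-option {p} a (won e)    = ⊥-elim (nonTerminal≢ p a e)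
winning-option     a (move m d) = _ , m , d

⊎⇒second? : ∀ {p s A} → p ⇄ s → First p A ⊎ Second s A → Dec (Second s A)
⊎⇒second? ps (inj₁ f) = no (first-second-exclusive ps f)
⊎⇒second? ps (inj₂ d) = yes d

-- Determinacy. It holds constructively because a winning option is searched for among finitely
-- many. It makes both kinds of win decidable and allows the later arguments by contradiction.
first-or-second : ∀ {p s} → p ⇄ s → ∀ A → First p A ⊎ Second s A
first-or-second 𝐋⇄𝐑 ∞ = inj₁ (won refl)
first-or-second 𝐋⇄𝐑 ∞̄ = inj₂ (won refl)
first-or-second 𝐑⇄𝐋 ∞ = inj₂ (won refl)
first-or-second 𝐑⇄𝐋 ∞̄ = inj₁ (won refl)
first-or-second 𝐋⇄𝐑 ⟨ L ∣ R ⟩ with any? (λ i → ⊎⇒second? 𝐑⇄𝐋 (first-or-second 𝐑⇄𝐋 (L i)))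
... | yes (i , d) = inj₁ (move (left i) d)
... | no ¬d = inj₂ (reply nt λ { 𝐑⇄𝐋 (left i) →
        fromInj₁ (λ d → ⊥-elim (¬d (i , d))) (first-or-second 𝐑⇄𝐋 (L i)) })
first-or-second 𝐑⇄𝐋 ⟨ L ∣ R ⟩ with any? (λ j → ⊎⇒second? 𝐋⇄𝐑 (first-or-second 𝐋⇄𝐑 (R j)))
... | yes (j , d) = inj₁ (move (right j) d)
... | no ¬d = inj₂ (reply nt λ { 𝐋⇄𝐑 (right j) →
        fromInj₁ (λ d → ⊥-elim (¬d (j , d))) (first-or-second 𝐋⇄𝐑 (R j)) })

first? : ∀ p A → Dec (First p A)
first? p A with opponent p
... | s , ps with first-or-second ps A
... | inj₁ f = yes f
... | inj₂ d = no λ f → first-second-exclusive ps f d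

second? : ∀ p A → Dec (Second p A)
second? p A with opponent p
... | s , ps = ⊎⇒second? (⇄-sym ps) (first-or-second (⇄-sym ps) A)

winner : Player → Game → Player
winner 𝐋 = oᴸ
winner 𝐑 = oᴿ

winner-terminal : ∀ q p → winner q (terminal p) ≡ p
winner-terminal 𝐋 𝐋 = refl
winner-terminal 𝐋 𝐑 = refl
winner-terminal 𝐑 𝐋 = refl
winner-terminal 𝐑 𝐑 = refl

mutual
  first⇒winner : ∀ {p A} → First p A → winner p A ≡ p
  first⇒winner {p} (won refl) = winner-terminal p p
  first⇒winner (move (left {L = L} i) d)
    rewrite dec-true (any? λ i → oᴿ (L i) ≟ 𝐋) (i , second⇒winner 𝐋⇄𝐑 d) = refl
  first⇒winner (move (right {R = R} j) d)
    rewrite dec-true (any? λ j → oᴸ (R j) ≟ 𝐑) (j , second⇒winner 𝐑⇄𝐋 d) = refl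

  second⇒winner : ∀ {p s A} → p ⇄ s → Second p A → winner s A ≡ p
  second⇒winner {p} {s} ps (won refl) = winner-terminal s p
  second⇒winner {A = ∞} ps (reply a _) = ⊥-elim (proj₁ a refl)
  second⇒winner {A = ∞̄} ps (reply a _) = ⊥-elim (proj₂ a refl)
  second⇒winner {A = ⟨ L ∣ R ⟩} 𝐋⇄𝐑 (reply _ f)
    rewrite dec-false (any? λ j → oᴸ (R j) ≟ 𝐑)
      (λ { (j , e) → ⇄⇒≢ 𝐋⇄𝐑 (trans (sym (first⇒winner (f 𝐋⇄𝐑 (right j)))) e) }) = refl
  second⇒winner {A = ⟨ L ∣ R ⟩} 𝐑⇄𝐋 (reply _ f)
    rewrite dec-false (any? λ i → oᴿ (L i) ≟ 𝐋)
      (λ { (i , e) → ⇄⇒≢ 𝐑⇄𝐋 (trans (sym (first⇒winner (f 𝐑⇄𝐋 (left i)))) e) }) = refl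

winner⇒second : ∀ {p s A} → p ⇄ s → winner s A ≡ p → Second p A
winner⇒second {p} {s} {A} ps e with first-or-second (⇄-sym ps) A
... | inj₁ f = ⊥-elim (⇄⇒≢ ps (trans (sym e) (first⇒winner f)))
... | inj₂ d = d

-- Implications in one direction suffice, because they are assumed for both players and both roles:
-- by determinacy either `q` wins `A` moving first or the opponent wins it moving second, and each
-- carries over to `B`.
winner-unique : ∀ {A B} → (∀ {p} → First p A → First p B) → (∀ {p} → Second p A → Second p B) →
            ∀ q → winner q A ≡ winner q B
winner-unique {A} first second q with opponent q
... | s , qs with first-or-second qs A
... | inj₁ f = trans (first⇒winner f) (sym (first⇒winner (first f)))
... | inj₂ d = trans (second⇒winner (⇄-sym qs) d) (sym (second⇒winner (⇄-sym qs) (second d)))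

-- Disjunctive sums made total.

summable? : ∀ A B → Dec (Summable A B)
summable? ∞         ∞̄         = no λ d → proj₁ d (refl , refl)
summable? ∞̄         ∞         = no λ d → proj₂ d (refl , refl)
summable? ∞         ∞         = yes ((λ ()) , (λ ()))
summable? ∞̄         ∞̄         = yes ((λ ()) , (λ ()))
summable? ∞         ⟨ _ ∣ _ ⟩ = yes ((λ ()) , (λ ()))
summable? ∞̄         ⟨ _ ∣ _ ⟩ = yes ((λ ()) , (λ ()))
summable? ⟨ _ ∣ _ ⟩ B         = yes ((λ ()) , (λ ()))

infixl 6 _⊕_

-- The value of the undefined sum ∞ + ∞̄ is chosen so that ⊕ is associative.
_⊕_ : Game → Game → Game
A ⊕ B with summable? A B
... | yes d = A + B [ d ]
... | no _  = ∞̄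

+≡⊕ : ∀ A B .(d : Summable A B) → A + B [ d ] ≡ A ⊕ B
+≡⊕ A B d with summable? A B
... | yes _ = refl
... | no ¬d = ⊥-elim-irr (¬d d)

⊕-nonTerminal : ∀ {A B} → NonTerminal A → NonTerminal B → NonTerminal (A ⊕ B)
⊕-nonTerminal {∞} a b = ⊥-elim (proj₁ a refl)
⊕-nonTerminal {∞̄} a b = ⊥-elim (proj₂ a refl)
⊕-nonTerminal {⟨ _ ∣ _ ⟩} {∞} a b = ⊥-elim (proj₁ b refl)
⊕-nonTerminal {⟨ _ ∣ _ ⟩} {∞̄} a b = ⊥-elim (proj₂ b refl)
⊕-nonTerminal {⟨ _ ∣ _ ⟩} {⟨ _ ∣ _ ⟩} a b = nt

terminal-⊕ : ∀ {p s} → p ⇄ s → ∀ {A} → A ≢ terminal s → terminal p ⊕ A ≡ terminal p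
terminal-⊕ 𝐋⇄𝐑 {∞} _ = refl
terminal-⊕ 𝐋⇄𝐑 {∞̄} A≢ = ⊥-elim (A≢ refl)
terminal-⊕ 𝐋⇄𝐑 {⟨ _ ∣ _ ⟩} _ = refl
terminal-⊕ 𝐑⇄𝐋 {∞} A≢ = refl
terminal-⊕ 𝐑⇄𝐋 {∞̄} _ = refl
terminal-⊕ 𝐑⇄𝐋 {⟨ _ ∣ _ ⟩} _ = refl

⊕-terminal : ∀ {p s} → p ⇄ s → ∀ {A} → A ≢ terminal s → A ⊕ terminal p ≡ terminal p
⊕-terminal 𝐋⇄𝐑 {∞} _ = refl
⊕-terminal 𝐋⇄𝐑 {∞̄} A≢ = ⊥-elim (A≢ refl)
⊕-terminal 𝐋⇄𝐑 {⟨ _ ∣ _ ⟩} _ = refl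
⊕-terminal 𝐑⇄𝐋 {∞} A≢ = refl
⊕-terminal 𝐑⇄𝐋 {∞̄} _ = refl
⊕-terminal 𝐑⇄𝐋 {⟨ _ ∣ _ ⟩} _ = refl

∞̄-⊕ : ∀ A → ∞̄ ⊕ A ≡ ∞̄
∞̄-⊕ ∞         = refl
∞̄-⊕ ∞̄         = refl
∞̄-⊕ ⟨ _ ∣ _ ⟩ = refl

⊕-∞̄ : ∀ A → A ⊕ ∞̄ ≡ ∞̄
⊕-∞̄ ∞         = refl
⊕-∞̄ ∞̄         = refl
⊕-∞̄ ⟨ _ ∣ _ ⟩ = refl

data SumOption (p : Player) (A B : Game) : Game → Set where
  inˡ : ∀ {A′} → A′ ∈[ p ] A → SumOption p A B (A′ ⊕ B)
  inʳ : ∀ {B′} → B′ ∈[ p ] B → SumOption p A B (A ⊕ B′)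

⊕-option : ∀ {p} A B {C} → C ∈[ p ] A ⊕ B → SumOption p A B C
⊕-option ∞ ∞ ()
⊕-option ∞ ∞̄ ()
⊕-option ∞ ⟨ _ ∣ _ ⟩ ()
⊕-option ∞̄ ∞ ()
⊕-option ∞̄ ∞̄ ()
⊕-option ∞̄ ⟨ _ ∣ _ ⟩ ()
⊕-option ⟨ _ ∣ _ ⟩ ∞ ()
⊕-option ⟨ _ ∣ _ ⟩ ∞̄ ()
⊕-option A@(⟨_∣_⟩ {m} L R) B@(⟨ L′ ∣ R′ ⟩) (left k) with splitAt (suc m) k
... | inj₁ i rewrite +≡⊕ (L i) B (summableʳ (L i) nt) = inˡ (left i)
... | inj₂ i rewrite +≡⊕ A (L′ i) (summableˡ (L′ i) nt) = inʳ (left i)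
⊕-option A@(⟨_∣_⟩ {n = n} L R) B@(⟨ L′ ∣ R′ ⟩) (right k) with splitAt (suc n) k
... | inj₁ i rewrite +≡⊕ (R i) B (summableʳ (R i) nt) = inˡ (right i)
... | inj₂ i rewrite +≡⊕ A (R′ i) (summableˡ (R′ i) nt) = inʳ (right i)

⊕-option-elim : ∀ {p A B C} (P : Game → Set) →
                (∀ {A′} → A′ ∈[ p ] A → P (A′ ⊕ B)) → (∀ {B′} → B′ ∈[ p ] B → P (A ⊕ B′)) →
                C ∈[ p ] A ⊕ B → P C
⊕-option-elim {A = A} {B} P l r m with ⊕-option A B m
... | inˡ m′ = l m′
... | inʳ m′ = r m′

option-⊕ˡ : ∀ {p A A′ B} → NonTerminal B → A′ ∈[ p ] A → A′ ⊕ B ∈[ p ] A ⊕ B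
option-⊕ˡ {B = ∞} b _ = ⊥-elim (proj₁ b refl)
option-⊕ˡ {B = ∞̄} b _ = ⊥-elim (proj₂ b refl)
option-⊕ˡ {B = B@(⟨ _ ∣ _ ⟩)} b (left {L = L} i) =
  subst (_∈[ 𝐋 ] _) (trans (lookup-++ˡ _ _ i) (+≡⊕ (L i) B (summableʳ (L i) b))) (left (i ↑ˡ _))
option-⊕ˡ {B = B@(⟨ _ ∣ _ ⟩)} b (right {R = R} i) =
  subst (_∈[ 𝐑 ] _) (trans (lookup-++ˡ _ _ i) (+≡⊕ (R i) B (summableʳ (R i) b))) (right (i ↑ˡ _))

option-⊕ʳ : ∀ {p A B B′} → NonTerminal A → B′ ∈[ p ] B → A ⊕ B′ ∈[ p ] A ⊕ B
option-⊕ʳ {A = ∞} a _ = ⊥-elim (proj₁ a refl)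
option-⊕ʳ {A = ∞̄} a _ = ⊥-elim (proj₂ a refl)
option-⊕ʳ {A = A@(⟨_∣_⟩ {m} _ _)} a (left {L = L} i) =
  subst (_∈[ 𝐋 ] _) (trans (lookup-++ʳ {m = suc m} _ _ i) (+≡⊕ A (L i) (summableˡ (L i) a)))
    (left (suc m ↑ʳ i))
option-⊕ʳ {A = A@(⟨_∣_⟩ {n = n} _ _)} a (right {R = R} i) =
  subst (_∈[ 𝐑 ] _) (trans (lookup-++ʳ {m = suc n} _ _ i) (+≡⊕ A (R i) (summableˡ (R i) a)))
    (right (suc n ↑ʳ i))

-- Bisimilarity and the laws of sums.

_◁_ : Game → Game → Set
B ◁ A = ∃ λ p → B ∈[ p ] A

◁-wellFounded : WellFounded _◁_
◁-wellFounded ∞ = acc λ { (_ , ()) }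
◁-wellFounded ∞̄ = acc λ { (_ , ()) }
◁-wellFounded ⟨ L ∣ R ⟩ = acc λ where
  (_ , left i)  → ◁-wellFounded (L i)
  (_ , right j) → ◁-wellFounded (R j)

infix 4 _≅_

-- Options of sums agree only pointwise, so without function extensionality
-- the laws of ⊕ hold up to bisimulation rather than ≡.
data _≅_ : Game → Game → Set where
  leaf : ∀ p → terminal p ≅ terminal p
  node : ∀ {A B} → NonTerminal A → NonTerminal B →
         (∀ {p A′} → A′ ∈[ p ] A → ∃ λ B′ → B′ ∈[ p ] B × A′ ≅ B′) →
         (∀ {p B′} → B′ ∈[ p ] B → ∃ λ A′ → A′ ∈[ p ] A × A′ ≅ B′) →
         A ≅ B

Matchˡ Matchʳ : Player → Game → Game → Set
Matchˡ p A Y = ∃ λ X → X ∈[ p ] A × X ≅ Y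
Matchʳ p B X = ∃ λ Y → Y ∈[ p ] B × X ≅ Y

≅-refl : ∀ {A} → A ≅ A
≅-refl {∞} = leaf 𝐋
≅-refl {∞̄} = leaf 𝐑
≅-refl {⟨ L ∣ R ⟩} = node nt nt
  (λ { (left i) → _ , left i , ≅-refl ; (right j) → _ , right j , ≅-refl })
  (λ { (left i) → _ , left i , ≅-refl ; (right j) → _ , right j , ≅-refl })

≅-reflexive : ∀ {A B} → A ≡ B → A ≅ B
≅-reflexive refl = ≅-refl

≅-sym : ∀ {A B} → A ≅ B → B ≅ A
≅-sym (leaf p)     = leaf p
≅-sym (node a b to from) = node b a
  (λ m → let _ , m′ , e = from m in _ , m′ , ≅-sym e)
  (λ m → let _ , m′ , e = to m in _ , m′ , ≅-sym e)

≅-nonTerminal : ∀ {A B} → A ≅ B → NonTerminal A → NonTerminal B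
≅-nonTerminal (leaf _)   a = a
≅-nonTerminal (node _ b _ _) _ = b

≅-to : ∀ {A B p A′} → A ≅ B → A′ ∈[ p ] A → ∃ λ B′ → B′ ∈[ p ] B × A′ ≅ B′
≅-to (leaf q)    m = ⊥-elim (¬option-terminal q m)
≅-to (node _ _ to _) m = to m

≅-trans : ∀ {A B C} → A ≅ B → B ≅ C → A ≅ C
≅-trans (leaf _) e = e
≅-trans {C = C} (node a b to from) e = node a (≅-nonTerminal e b)
  (λ m → let _ , m₁ , e₁ = to m ; _ , m₂ , e₂ = ≅-to e m₁ in _ , m₂ , ≅-trans e₁ e₂)
  (λ m → let _ , m₁ , e₁ = ≅-from e m ; _ , m₂ , e₂ = from m₁ in _ , m₂ , ≅-trans e₂ e₁)
  where
  ≅-from : ∀ {A B p B′} → A ≅ B → B′ ∈[ p ] B → ∃ λ A′ → A′ ∈[ p ] A × A′ ≅ B′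
  ≅-from (leaf q)      m = ⊥-elim (¬option-terminal q m)
  ≅-from (node _ _ _ from) m = from m

⊕-cong : ∀ {A A′ B B′} → A ≅ A′ → B ≅ B′ → A ⊕ B ≅ A′ ⊕ B′
⊕-cong (leaf p) (leaf q) = ≅-refl
⊕-cong (leaf p) (node {B} {B′} b b′ _ _) with opponent p
... | s , ps = ≅-reflexive (trans (terminal-⊕ ps (nonTerminal≢ s b)) (sym (terminal-⊕ ps (nonTerminal≢ s b′))))
⊕-cong (node a a′ _ _) (leaf p) with opponent p
... | s , ps = ≅-reflexive (trans (⊕-terminal ps (nonTerminal≢ s a)) (sym (⊕-terminal ps (nonTerminal≢ s a′))))
⊕-cong e@(node a a′ toA fromA) f@(node b b′ toB fromB) =
  node (⊕-nonTerminal a b) (⊕-nonTerminal a′ b′)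
    (⊕-option-elim (Matchʳ _ _)
      (λ m → let _ , m′ , g = toA m in _ , option-⊕ˡ b′ m′ , ⊕-cong g f)
      (λ m → let _ , m′ , g = toB m in _ , option-⊕ʳ a′ m′ , ⊕-cong e g))
    (⊕-option-elim (Matchˡ _ _)
      (λ m → let _ , m′ , g = fromA m in _ , option-⊕ˡ b m′ , ⊕-cong g f)
      (λ m → let _ , m′ , g = fromB m in _ , option-⊕ʳ a m′ , ⊕-cong e g))

⊕-comm : ∀ A B → A ⊕ B ≅ B ⊕ A
⊕-comm A B = go (◁-wellFounded A) (◁-wellFounded B)
  where
  go : ∀ {A B} → Acc _◁_ A → Acc _◁_ B → A ⊕ B ≅ B ⊕ A
  go {∞}         {∞}         _ _ = ≅-refl
  go {∞}         {∞̄}         _ _ = ≅-refl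
  go {∞}         {⟨ _ ∣ _ ⟩} _ _ = ≅-refl
  go {∞̄}         {∞}         _ _ = ≅-refl
  go {∞̄}         {∞̄}         _ _ = ≅-refl
  go {∞̄}         {⟨ _ ∣ _ ⟩} _ _ = ≅-refl
  go {⟨ _ ∣ _ ⟩} {∞}         _ _ = ≅-refl
  go {⟨ _ ∣ _ ⟩} {∞̄}         _ _ = ≅-refl
  go {A@(⟨ _ ∣ _ ⟩)} {B@(⟨ _ ∣ _ ⟩)} (acc rsA) (acc rsB) =
    node nt nt
      (⊕-option-elim (Matchʳ _ _)
        (λ m → _ , option-⊕ʳ nt m , go (rsA (_ , m)) (acc rsB))
        (λ m → _ , option-⊕ˡ nt m , go (acc rsA) (rsB (_ , m))))
      (⊕-option-elim (Matchˡ _ _)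
        (λ m → _ , option-⊕ʳ nt m , go (acc rsA) (rsB (_ , m)))
        (λ m → _ , option-⊕ˡ nt m , go (rsA (_ , m)) (acc rsB)))

⊕-assoc : ∀ A B C → (A ⊕ B) ⊕ C ≅ A ⊕ (B ⊕ C)
⊕-assoc A B C = go (◁-wellFounded A) (◁-wellFounded B) (◁-wellFounded C)
  where
  go : ∀ {A B C} → Acc _◁_ A → Acc _◁_ B → Acc _◁_ C → (A ⊕ B) ⊕ C ≅ A ⊕ (B ⊕ C)
  -- `∞̄` absorbs every game, `∞` included, so a sum with `∞̄` among its three terms is `∞̄` under
  -- either bracketing.
  go {∞̄} {B} {C} _ _ _ rewrite ∞̄-⊕ B | ∞̄-⊕ C | ∞̄-⊕ (B ⊕ C) = ≅-refl
  go {A} {∞̄} {C} _ _ _ rewrite ⊕-∞̄ A | ∞̄-⊕ C | ⊕-∞̄ A = ≅-refl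
  go {A} {B} {∞̄} _ _ _ rewrite ⊕-∞̄ (A ⊕ B) | ⊕-∞̄ B | ⊕-∞̄ A = ≅-refl
  go {∞}         {∞}         {∞}         _ _ _ = ≅-refl
  go {∞}         {∞}         {⟨ _ ∣ _ ⟩} _ _ _ = ≅-refl
  go {∞}         {⟨ _ ∣ _ ⟩} {∞}         _ _ _ = ≅-refl
  go {∞}         {⟨ _ ∣ _ ⟩} {⟨ _ ∣ _ ⟩} _ _ _ = ≅-refl
  go {⟨ _ ∣ _ ⟩} {∞}         {∞}         _ _ _ = ≅-refl
  go {⟨ _ ∣ _ ⟩} {∞}         {⟨ _ ∣ _ ⟩} _ _ _ = ≅-refl
  go {⟨ _ ∣ _ ⟩} {⟨ _ ∣ _ ⟩} {∞}         _ _ _ = ≅-refl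
  go {A@(⟨ _ ∣ _ ⟩)} {B@(⟨ _ ∣ _ ⟩)} {C@(⟨ _ ∣ _ ⟩)} (acc rsA) (acc rsB) (acc rsC) =
    node nt nt
      (⊕-option-elim (Matchʳ _ _)
        (⊕-option-elim (λ X → Matchʳ _ _ (X ⊕ C))
          (λ m → _ , option-⊕ˡ nt m , go (rsA (_ , m)) (acc rsB) (acc rsC))
          (λ m → _ , option-⊕ʳ nt (option-⊕ˡ nt m) , go (acc rsA) (rsB (_ , m)) (acc rsC)))
        (λ m → _ , option-⊕ʳ nt (option-⊕ʳ nt m) , go (acc rsA) (acc rsB) (rsC (_ , m))))
      (⊕-option-elim (Matchˡ _ _)
        (λ m → _ , option-⊕ˡ nt (option-⊕ˡ nt m) , go (rsA (_ , m)) (acc rsB) (acc rsC))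
        (⊕-option-elim (λ X → Matchˡ _ _ (A ⊕ X))
          (λ m → _ , option-⊕ˡ nt (option-⊕ʳ nt m) , go (acc rsA) (rsB (_ , m)) (acc rsC))
          (λ m → _ , option-⊕ʳ nt m , go (acc rsA) (acc rsB) (rsC (_ , m)))))

⊕-commutativeSemigroup : CommutativeSemigroup _ _
⊕-commutativeSemigroup = record
  { _≈_ = _≅_
  ; _∙_ = _⊕_
  ; isCommutativeSemigroup = record
    { isSemigroup = record
      { isMagma = record
        { isEquivalence = record { refl = ≅-refl ; sym = ≅-sym ; trans = ≅-trans }
        ; ∙-cong = ⊕-cong
        }
      ; assoc = ⊕-assoc
      }
    ; comm = ⊕-comm
    }
  }

open CommutativeSemigroupProperties ⊕-commutativeSemigroup using (interchange)

-- Wins in sums, cancellation and null games.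

mutual
  first-resp-≅ : ∀ {p A B} → A ≅ B → First p A → First p B
  first-resp-≅ (leaf _) f = f
  first-resp-≅ {p} (node a _ _ _) (won e) = ⊥-elim (nonTerminal≢ p a e)
  first-resp-≅ (node _ _ to _) (move m d) =
    let _ , m′ , e = to m in move m′ (second-resp-≅ e d)

  second-resp-≅ : ∀ {p A B} → A ≅ B → Second p A → Second p B
  second-resp-≅ (leaf _) d = d
  second-resp-≅ {p} (node a _ _ _) (won e) = ⊥-elim (nonTerminal≢ p a e)
  second-resp-≅ (node _ b _ from) (reply _ f) = reply b λ ps m →
    let _ , m′ , e = from m in first-resp-≅ e (f ps m′)

mutual
  second+first : ∀ {p s A B} → p ⇄ s → Second p A → First p B → First p (A ⊕ B)
  second+first {A = A} {B} ps d f with view ps A | view ps B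
  ... | theirs    | _         = ⊥-elim (¬second-terminal ps d)
  ... | _         | theirs    = ⊥-elim (¬first-terminal ps f)
  ... | mine      | mine      = won (terminal-⊕ ps (terminal-distinct ps))
  ... | mine      | neither b = won (terminal-⊕ ps (nonTerminal≢ _ b))
  ... | neither a | mine      = won (⊕-terminal ps (nonTerminal≢ _ a))
  second+first ps d (won e)     | neither a | neither b = ⊥-elim (nonTerminal≢ _ b e)
  second+first ps d (move m d′) | neither a | neither b =
    -- The opening move is the winning one in `B`; from then on `p` is second in both summands.
    move (option-⊕ʳ a m) (second+second ps d d′)

  second+second : ∀ {p s A B} → p ⇄ s → Second p A → Second p B → Second p (A ⊕ B)
  second+second {A = A} {B} ps d e with view ps A | view ps B
  ... | theirs    | _         = ⊥-elim (¬second-terminal ps d)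
  ... | _         | theirs    = ⊥-elim (¬second-terminal ps e)
  ... | mine      | mine      = won (terminal-⊕ ps (terminal-distinct ps))
  ... | mine      | neither b = won (terminal-⊕ ps (nonTerminal≢ _ b))
  ... | neither a | mine      = won (⊕-terminal ps (nonTerminal≢ _ a))
  second+second ps (won q) e | neither a | neither b = ⊥-elim (nonTerminal≢ _ a q)
  second+second ps d (won q) | neither a | neither b = ⊥-elim (nonTerminal≢ _ b q)
  second+second {p} {A = A} {B} ps d@(reply _ f) e@(reply _ g) | neither a | neither b =
    reply (⊕-nonTerminal a b) λ ps′ → ⊕-option-elim (First p)
      (λ {A′} m → first-resp-≅ (⊕-comm B A′) (second+first ps e (f ps′ m)))
      (λ m → second+first ps d (g ps′ m))

-- By determinacy: otherwise `s` would win both summands moving second, hence the sum.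
cancel-first : ∀ {p s A B} → p ⇄ s → Second s A → First p (A ⊕ B) → First p B
cancel-first {B = B} ps d f with first-or-second ps B
... | inj₁ g = g
... | inj₂ e = ⊥-elim (first-second-exclusive ps f (second+second (⇄-sym ps) d e))

cancel-second : ∀ {p s A B} → p ⇄ s → Second s A → Second p (A ⊕ B) → Second p B
cancel-second {B = B} ps d e with first-or-second (⇄-sym ps) B
... | inj₁ f = ⊥-elim (first-second-exclusive (⇄-sym ps) (second+first (⇄-sym ps) d f) e)
... | inj₂ g = g

Null : Game → Set
Null A = ∀ p → Second p A

-- Regroup (A + B) + (C + D) as (B + D) + (A + C) and cancel B + D. This does the work of
-- transitivity of the order on games: when B + D is null, D acts as the negative of B.
cut-first : ∀ {p s} A B C D → p ⇄ s →
            Second p (A ⊕ B) → First p (C ⊕ D) → Second s (B ⊕ D) → First p (A ⊕ C)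
cut-first A B C D ps d f e = cancel-first ps e
  (first-resp-≅ (≅-trans (interchange A B C D) (⊕-comm (A ⊕ C) (B ⊕ D))) (second+first ps d f))

cut-second : ∀ {p s} A B C D → p ⇄ s →
             Second p (A ⊕ B) → Second p (C ⊕ D) → Second s (B ⊕ D) → Second p (A ⊕ C)
cut-second A B C D ps d e f = cancel-second ps f
  (second-resp-≅ (≅-trans (interchange A B C D) (⊕-comm (A ⊕ C) (B ⊕ D))) (second+second ps d e))

first-comm : ∀ {p} A B → First p (A ⊕ B) → First p (B ⊕ A)
first-comm A B = first-resp-≅ (⊕-comm A B)

second-comm : ∀ {p} A B → Second p (A ⊕ B) → Second p (B ⊕ A)
second-comm A B = second-resp-≅ (⊕-comm A B)

null-comm : ∀ A B → Null (A ⊕ B) → Null (B ⊕ A)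
null-comm A B null p = second-comm A B (null p)

null-intro : ∀ {p s A} → p ⇄ s → Second p A → Second s A → Null A
null-intro 𝐋⇄𝐑 d e 𝐋 = d
null-intro 𝐋⇄𝐑 d e 𝐑 = e
null-intro 𝐑⇄𝐋 d e 𝐋 = e
null-intro 𝐑⇄𝐋 d e 𝐑 = d

¬null-terminal : ∀ p → ¬ Null (terminal p)
¬null-terminal p null with opponent p
... | s , ps = ¬second-terminal (⇄-sym ps) (null s)

null-nonTerminalˡ : ∀ A B → Null (A ⊕ B) → NonTerminal A
null-nonTerminalˡ ∞ ∞         null = ⊥-elim (¬null-terminal 𝐋 null)
null-nonTerminalˡ ∞ ∞̄         null = ⊥-elim (¬null-terminal 𝐑 null)
null-nonTerminalˡ ∞ ⟨ _ ∣ _ ⟩ null = ⊥-elim (¬null-terminal 𝐋 null)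
null-nonTerminalˡ ∞̄ B null rewrite ∞̄-⊕ B = ⊥-elim (¬null-terminal 𝐑 null)
null-nonTerminalˡ ⟨ _ ∣ _ ⟩ _ _ = nt

null-nonTerminalʳ : ∀ A B → Null (A ⊕ B) → NonTerminal B
null-nonTerminalʳ A B null = null-nonTerminalˡ B A (null-comm A B null)

-- Followers and search among options.

properFollowers : Game → List Game
properFollowers ∞ = []
properFollowers ∞̄ = []
properFollowers ⟨ L ∣ R ⟩ =
  concat (tabulate λ i → L i ∷ properFollowers (L i)) ++
  concat (tabulate λ j → R j ∷ properFollowers (R j))

data OptionOrBeyond (G E : Game) : Set where
  option : ∀ {p} → E ∈[ p ] G → OptionOrBeyond G E
  beyond : ∀ {p D} → D ∈[ p ] G → E ∈ properFollowers D → OptionOrBeyond G E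

∈-concat-tabulate-∷⁺ : ∀ {n E} (f : Fin n → Game) (g : Game → List Game) i →
                       E ∈ f i ∷ g (f i) → E ∈ concat (tabulate λ i → f i ∷ g (f i))
∈-concat-tabulate-∷⁺ f g i m = ∈-concat⁺′ m (∈-tabulate⁺ {f = λ i → f i ∷ g (f i)} i)

∈-properFollowers⁺ : ∀ G {E} → OptionOrBeyond G E → E ∈ properFollowers G
∈-properFollowers⁺ ⟨ L ∣ R ⟩ (option (left i)) =
  ∈-++⁺ˡ (∈-concat-tabulate-∷⁺ L properFollowers i (here refl))
∈-properFollowers⁺ ⟨ L ∣ R ⟩ (option (right j)) =
  ∈-++⁺ʳ (concat (tabulate λ i → L i ∷ properFollowers (L i)))
    (∈-concat-tabulate-∷⁺ R properFollowers j (here refl))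
∈-properFollowers⁺ ⟨ L ∣ R ⟩ (beyond (left i) m) =
  ∈-++⁺ˡ (∈-concat-tabulate-∷⁺ L properFollowers i (there m))
∈-properFollowers⁺ ⟨ L ∣ R ⟩ (beyond (right j) m) =
  ∈-++⁺ʳ (concat (tabulate λ i → L i ∷ properFollowers (L i)))
    (∈-concat-tabulate-∷⁺ R properFollowers j (there m))

∈-concat-tabulate-∷⁻ : ∀ {n E} (f : Fin n → Game) (g : Game → List Game) →
                       E ∈ concat (tabulate λ i → f i ∷ g (f i)) →
                       ∃ λ i → E ≡ f i ⊎ E ∈ g (f i)
∈-concat-tabulate-∷⁻ f g m with ∈-concat⁻′ (tabulate λ i → f i ∷ g (f i)) m
... | _ , m′ , t with ∈-tabulate⁻ {f = λ i → f i ∷ g (f i)} t | m′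
... | i , refl | here e  = i , inj₁ e
... | i , refl | there k = i , inj₂ k

∈-properFollowers⁻ : ∀ G {E} → E ∈ properFollowers G → OptionOrBeyond G E
∈-properFollowers⁻ ⟨ L ∣ R ⟩ m
  with ∈-++⁻ (concat (tabulate λ i → L i ∷ properFollowers (L i))) m
... | inj₁ l with ∈-concat-tabulate-∷⁻ L properFollowers l
...   | i , inj₁ refl = option (left i)
...   | i , inj₂ k    = beyond (left i) k
∈-properFollowers⁻ ⟨ L ∣ R ⟩ m | inj₂ r with ∈-concat-tabulate-∷⁻ R properFollowers r
...   | j , inj₁ refl = option (right j)
...   | j , inj₂ k    = beyond (right j) k

properFollowers-option : ∀ G {p D E} → D ∈ properFollowers G → E ∈[ p ] D → E ∈ properFollowers G
properFollowers-option G {D = D} m k with ∈-properFollowers⁻ G m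
properFollowers-option G {D = D} m k | option l =
  ∈-properFollowers⁺ G (beyond l (∈-properFollowers⁺ D (option k)))
properFollowers-option G@(⟨ L ∣ R ⟩) m k | beyond (left i) m′ =
  ∈-properFollowers⁺ G (beyond (left i) (properFollowers-option (L i) m′ k))
properFollowers-option G@(⟨ L ∣ R ⟩) m k | beyond (right j) m′ =
  ∈-properFollowers⁺ G (beyond (right j) (properFollowers-option (R j) m′ k))

-- Needed in place of structural induction because the invertible games found inside `G` may lie
-- several moves below it.
follower-induction : (P : Game → Set) →
                     (∀ G → (∀ {E} → E ∈ properFollowers G → P E) → P G) → ∀ G → P G
follower-induction P step G = step G (below G)
  where
  below : ∀ G {E} → E ∈ properFollowers G → P E
  below G m with ∈-properFollowers⁻ G m
  below ⟨ L ∣ R ⟩ m | option (left i)     = step (L i) (below (L i))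
  below ⟨ L ∣ R ⟩ m | option (right j)    = step (R j) (below (R j))
  below ⟨ L ∣ R ⟩ m | beyond (left i) m′  = below (L i) m′
  below ⟨ L ∣ R ⟩ m | beyond (right j) m′ = below (R j) m′

any-option? : ∀ p A {P : Game → Set} → (∀ B → Dec (P B)) → Dec (∃ λ B → B ∈[ p ] A × P B)
any-option? p ∞ P? = no λ { (_ , () , _) }
any-option? p ∞̄ P? = no λ { (_ , () , _) }
any-option? 𝐋 ⟨ L ∣ R ⟩ P? with any? (λ i → P? (L i))
... | yes (i , b) = yes (_ , left i , b)
... | no ¬b = no λ { (_ , left i , b) → ¬b (i , b) }
any-option? 𝐑 ⟨ L ∣ R ⟩ P? with any? (λ j → P? (R j))
... | yes (j , b) = yes (_ , right j , b)
... | no ¬b = no λ { (_ , right j , b) → ¬b (j , b) }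

nonTerminal? : ∀ A → Dec (NonTerminal A)
nonTerminal? ∞         = no λ a → proj₁ a refl
nonTerminal? ∞̄         = no λ a → proj₂ a refl
nonTerminal? ⟨ _ ∣ _ ⟩ = yes nt

-- Bypassing reversible options.

Reversible : Player → Game → Game → Set
Reversible s H E = ∃ λ D → D ∈[ s ] E × Second s (D ⊕ H)

reversible? : ∀ s H E → Dec (Reversible s H E)
reversible? s H E = any-option? s E λ D → second? s (D ⊕ H)

-- With H = −G, an option of G for the opponent of s that is not reversible,
-- or a follower reached from one by bypassing reversible options.
Essential : Player → Game → Game → Set
Essential s H E = NonTerminal E × First s (E ⊕ H) × ¬ Reversible s H E

essential? : ∀ s H E → Dec (Essential s H E)
essential? s H E = nonTerminal? E ×-dec first? s (E ⊕ H) ×-dec ¬? (reversible? s H E)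

-- If `E` reverses through `D`, let `s` move from W + E to W + D and look at the winning reply of
-- `p`. A reply in `W` stays good when `D` is replaced by `G`, which is at least as good for `p`. A
-- reply in `D` is a new candidate for `E`, two moves further down.
bypass : ∀ {p s G H W E} → p ⇄ s → Null (G ⊕ H) → NonTerminal W → Acc _◁_ E →
         E ∈ properFollowers G → First s (E ⊕ H) → Second p (W ⊕ E) →
         (∃ λ W′ → W′ ∈[ p ] W × Second p (W′ ⊕ G)) ⊎
         (∃ λ E′ → E′ ∈ properFollowers G × Essential s H E′ × Second p (W ⊕ E′))
bypass {p} {s} {G} {H} {W} {E} ps null w (acc rs) E∈ f d with reversible? s H E
... | no ¬r = inj₂ (E , E∈ , (e , f , ¬r) , d)
  where
  e : NonTerminal E
  e with view ps E
  ... | mine = ⊥-elim (¬first-terminal (⇄-sym ps)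
                 (subst (First s) (terminal-⊕ ps (nonTerminal≢ s (null-nonTerminalʳ G H null))) f))
  ... | theirs = ⊥-elim (¬second-terminal ps (subst (Second p) (⊕-terminal (⇄-sym ps) (nonTerminal≢ p w)) d))
  ... | neither e = e
... | yes (D , m , r) with view ps D
-- A terminal `D` is impossible: one won by `p` contradicts the win of `s` on D + H, one won by `s`
-- contradicts the win of `p` on W + E.
... | mine = ⊥-elim (¬second-terminal (⇄-sym ps)
               (subst (Second s) (terminal-⊕ ps (nonTerminal≢ s (null-nonTerminalʳ G H null))) r))
... | theirs = ⊥-elim (¬first-terminal ps
                 (subst (First p) (⊕-terminal (⇄-sym ps) (nonTerminal≢ p w)) (first-reply ps d (option-⊕ʳ w m))))
... | neither nD with winning-option (⊕-nonTerminal w nD) (first-reply ps d (option-⊕ʳ w m))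
... | _ , m′ , d′ with ⊕-option W D m′
... | inˡ {W′} k = inj₁ (_ , k , cut-second W′ D G H ps d′ (null p) r)
... | inʳ k with rs (_ , m)
-- As `s` wins D + H moving second, `s` can answer this move of `p`, which restores the hypothesis
-- on E + H.
... | acc rs′ = bypass ps null w (rs′ (_ , k)) (properFollowers-option G (properFollowers-option G E∈ m) k)
                  (first-reply (⇄-sym ps) r (option-⊕ˡ (null-nonTerminalʳ G H null) k)) d′

-- The winning move of `s` in E + H cannot be in `E`, which is not reversible, so it is in `H`.
-- Bypassing then runs with the players and the games `G` and `H` exchanged and with `E` as the
-- context; its first alternative would again make `E` reversible.
answer : ∀ {p s G H E} → p ⇄ s → Null (G ⊕ H) → Essential s H E →
         ∃ λ F → F ∈ properFollowers H × Essential p G F × Second s (E ⊕ F)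
answer {p} {s} {G} {H} {E} ps null (e , f , ¬r)
  with winning-option (⊕-nonTerminal e (null-nonTerminalʳ G H null)) f
... | _ , m , d with ⊕-option E H m
... | inˡ k = ⊥-elim (¬r (_ , k , d))
... | inʳ {F} k with bypass (⇄-sym ps) (null-comm G H null) e (◁-wellFounded F) (∈-properFollowers⁺ H (option k))
                      (first-comm G F (first-reply ps (null p) (option-⊕ʳ (null-nonTerminalˡ G H null) k))) d
... | inj₁ r = ⊥-elim (¬r r)
... | inj₂ a = a

-- Strict improvement among essential options.

-- Read for Left as `p`, this is E ≤ -F < E′. The separating `F` stands in for a comparison of `E`
-- with `E′`, since their conjugates need not be negatives.
Improves : Player → Player → Game → Game → Set
Improves p s E E′ = ∃ λ F → Second s (E ⊕ F) × Second p (E′ ⊕ F) × ¬ Second s (E′ ⊕ F)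

improves-irrefl : ∀ {p s E} → ¬ Improves p s E E
improves-irrefl (_ , d , _ , ¬d) = ¬d d

-- The first separator serves for the composite; strictness comes from the second link, since a win
-- of `s` on C + F moving second would carry over to C + F′.
improves-trans : ∀ {p s} → p ⇄ s → ∀ {A B C} → Improves p s A B → Improves p s B C → Improves p s A C
improves-trans ps {A} {B} {C} (F , a , b , _) (F′ , b′ , c , ¬c) =
  F , a , cut-second C F′ F B ps c (second-comm B F b) (second-comm B F′ b′) ,
  λ c′ → ¬c (cut-second C F F′ B (⇄-sym ps) c′ (second-comm B F′ b′) (second-comm B F b))

-- Comparing positions in a list places the strict order on a finite set, where it has no infinite
-- ascent.
improves-wellFounded : ∀ {p s} → p ⇄ s → (xs : List Game) →
                       WellFounded (λ j i → Improves p s (lookup xs i) (lookup xs j))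
improves-wellFounded ps xs = spo-wellFounded record
  { isEquivalence = isEquivalence
  ; irrefl        = λ { {i} refl → improves-irrefl {E = lookup xs i} }
  ; trans         = λ {i} {j} {k} i<j j<k →
      improves-trans ps {lookup xs k} {lookup xs j} {lookup xs i} j<k i<j
  ; <-resp-≈      = resp₂ _
  }

-- Answering an essential option E by F, and F by E′, gives E + F on one side of 0
-- and E′ + F on the other. Either E′ + F = 0 or E′ strictly improves on E.
invertible-improvement :
  ∀ {p s G H} → p ⇄ s → Null (G ⊕ H) → ∀ i →
  Acc (λ j i → Improves p s (lookup (G ∷ properFollowers G) i) (lookup (G ∷ properFollowers G) j)) i →
  Essential s H (lookup (G ∷ properFollowers G) i) →
  ∃ λ E → ∃ λ F → E ∈ properFollowers G × First s (E ⊕ H) × Null (E ⊕ F) ×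
    (∀ W → Second p (W ⊕ lookup (G ∷ properFollowers G) i) → Second p (W ⊕ E))
invertible-improvement {p} {s} {G} {H} ps null i (acc rs) ess
  with answer ps null ess
... | F , _ , essF , d with answer (⇄-sym ps) (null-comm G H null) essF
... | E , E∈ , ess′@(_ , f , _) , d′ with second? s (E ⊕ F)
... | yes z = E , F , E∈ , f , isNull , better
  where
  isNull : Null (E ⊕ F)
  isNull = null-intro ps (second-comm F E d′) z
  better : ∀ W → Second p (W ⊕ lookup (G ∷ properFollowers G) i) → Second p (W ⊕ E)
  better W w = cut-second W (lookup (G ∷ properFollowers G) i) E F ps w (second-comm F E d′) d
... | no ¬z with lookup-index (there {x = G} E∈)
-- `F` itself witnesses the strict improvement, so the search continues from the position of the new
-- option.
... | e with invertible-improvement ps null (index (there {x = G} E∈))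
               (rs (F , d , subst (λ X → Second p (X ⊕ F)) e (second-comm F E d′) ,
                    subst (λ X → ¬ Second s (X ⊕ F)) e ¬z))
               (subst (Essential s H) e ess′)
... | E″ , F″ , E″∈ , f″ , null″ , better =
  E″ , F″ , E″∈ , f″ , null″ , λ W w → better W (subst (λ X → Second p (W ⊕ X)) e
    (cut-second W (lookup (G ∷ properFollowers G) i) E F ps w (second-comm F E d′) d))

-- Conway forms described through their options.

conwayForm-intro : ∀ {K} → NonTerminal K →
                   (∀ {p s B} → p ⇄ s → B ∈[ p ] K → B ≡ terminal s ⊎ ConwayForm B) → ConwayForm K
conwayForm-intro {K} k options = k , followers
  where
  ¬check : ∀ {p s} → p ⇄ s → ¬ terminal p ∈[ p ] K
  ¬check {p} ps m with options ps m
  ... | inj₁ e = terminal-distinct ps e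
  ... | inj₂ c = nonTerminal≢ p (proj₁ c) refl
  ¬check-terminal : ∀ p {B} → B IsFollowerOf terminal p → ¬ Check B
  ¬check-terminal 𝐋 ε (inj₁ ())
  ¬check-terminal 𝐋 ε (inj₂ ())
  ¬check-terminal 𝐑 ε (inj₁ ())
  ¬check-terminal 𝐑 ε (inj₂ ())
  ¬check-terminal 𝐋 (inj₁ () ◅ _)
  ¬check-terminal 𝐋 (inj₂ () ◅ _)
  ¬check-terminal 𝐑 (inj₁ () ◅ _)
  ¬check-terminal 𝐑 (inj₂ () ◅ _)
  below : ∀ {p s A B} → p ⇄ s → A ∈[ p ] K → B IsFollowerOf A → ¬ Check B
  below {s = s} ps m st with options ps m
  ... | inj₁ refl = ¬check-terminal s st
  ... | inj₂ c    = proj₂ c _ st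
  followers : ∀ B → B IsFollowerOf K → ¬ Check B
  followers _ ε (inj₁ m) = ¬check 𝐋⇄𝐑 (∈ᴸ⇒∈ m)
  followers _ ε (inj₂ m) = ¬check 𝐑⇄𝐋 (∈ᴿ⇒∈ m)
  followers _ (inj₁ m ◅ st) = below 𝐋⇄𝐑 (∈ᴸ⇒∈ m) st
  followers _ (inj₂ m ◅ st) = below 𝐑⇄𝐋 (∈ᴿ⇒∈ m) st

conwayForm-option : ∀ {p s K B} → p ⇄ s → ConwayForm K → B ∈[ p ] K → B ≡ terminal s ⊎ ConwayForm B
conwayForm-option {B = B} ps (k , ¬check) m with view ps B
conwayForm-option 𝐋⇄𝐑 (k , ¬check) m | mine = ⊥-elim (¬check _ ε (inj₁ (∈⇒∈ᴸ m)))
conwayForm-option 𝐑⇄𝐋 (k , ¬check) m | mine = ⊥-elim (¬check _ ε (inj₂ (∈⇒∈ᴿ m)))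
... | theirs    = inj₁ refl
... | neither b = inj₂ (b , λ C st → ¬check C (option⇒⟶ m ◅ st))

-- Replacing the options of a game while keeping its inverse.

module _ {G H K} (null : Null (G ⊕ H)) (k : NonTerminal K)
  (sound : ∀ {p s B} → p ⇄ s → B ∈[ p ] K → First s (B ⊕ H))
  (complete : ∀ {p s E} → p ⇄ s → E ∈ properFollowers G → Essential s H E →
              ∀ W → Second p (W ⊕ E) → ∃ λ B → B ∈[ p ] K × Second p (W ⊕ B))
  where

  private
    g : NonTerminal G
    g = null-nonTerminalˡ G H null

  mutual
    -- A strategy on Z + G is carried to Z + K. Moves in `Z` are copied. A winning move of `p` in
    -- `G` is bypassed to a move in `Z` or to an essential option, for which `complete` supplies an
    -- option of `K`.
    first-preserved : ∀ {p s Z} → p ⇄ s → Acc _◁_ Z → First p (Z ⊕ G) → First p (Z ⊕ K)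
    first-preserved {p} {s} {Z} ps (acc rs) f with view ps Z
    ... | mine = won (terminal-⊕ ps (nonTerminal≢ s k))
    ... | theirs = ⊥-elim (¬first-terminal ps (subst (First p) (terminal-⊕ (⇄-sym ps) (nonTerminal≢ p g)) f))
    ... | neither z with winning-option (⊕-nonTerminal z g) f
    ... | _ , m , d with ⊕-option Z G m
    ... | inˡ l = move (option-⊕ˡ k l) (second-preserved ps (rs (_ , l)) d)
    ... | inʳ {E} l with bypass ps null z (◁-wellFounded E) (∈-properFollowers⁺ G (option l))
                          (first-reply (⇄-sym ps) (null s) (option-⊕ˡ (null-nonTerminalʳ G H null) l)) d
    ... | inj₁ (_ , l′ , d′) = move (option-⊕ˡ k l′) (second-preserved ps (rs (_ , l′)) d′)
    ... | inj₂ (_ , E∈ , e , d′) with complete ps E∈ e Z d′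
    ... | _ , l′ , d″ = move (option-⊕ʳ z l′) d″

    second-preserved : ∀ {p s Z} → p ⇄ s → Acc _◁_ Z → Second p (Z ⊕ G) → Second p (Z ⊕ K)
    second-preserved {p} {s} {Z} ps (acc rs) d with view ps Z
    ... | mine = won (terminal-⊕ ps (nonTerminal≢ s k))
    ... | theirs = ⊥-elim (¬second-terminal ps (subst (Second p) (terminal-⊕ (⇄-sym ps) (nonTerminal≢ p g)) d))
    ... | neither z = reply (⊕-nonTerminal z k) λ {s′} ps′ → ⊕-option-elim (First p)
      (λ m → first-preserved ps′ (rs (_ , m)) (first-reply ps′ d (option-⊕ˡ g m)))
      -- The opponent's move in `K` has no counterpart in `G`; `sound` says that it loses against
      -- `H`, and cancelling G + H transfers this to `Z`.
      (λ {B} m → cut-first Z G B H ps′ d (sound (⇄-sym ps′) m) (null s′))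

  null-preserved : Null (K ⊕ H)
  null-preserved p = let s , ps = opponent p in
    -- The context `Z` is `H`, where G + H is a win for either player moving second.
    second-comm H K (second-preserved ps (◁-wellFounded H) (second-comm G H (null p)))

-- Construction of an equal Conway form.

-- `H` is quantified inside so that induction applies to a follower `E` with its own inverse `F`.
HasConwayInverses : Game → Set
HasConwayInverses G = ∀ H → Null (G ⊕ H) → ∃ λ K → ConwayForm K × Null (K ⊕ H)

module ConwayInverse (G H : Game) (null : Null (G ⊕ H))
  (ih : ∀ {E} → E ∈ properFollowers G → HasConwayInverses E) where

  -- Prepending G makes the list nonempty, as options of a form must be.
  candidates : List Game
  candidates = G ∷ properFollowers G

  record Component {p s} (ps : p ⇄ s) (E : Game) : Set where
    field
      game     : Game
      conway   : game ≡ terminal s ⊎ ConwayForm game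
      sound    : First s (game ⊕ H)
      complete : Essential s H E → ∀ W → Second p (W ⊕ E) → Second p (W ⊕ game)

  open Component

  component : ∀ {p s} (ps : p ⇄ s) i → Component ps (lookup candidates i)
  component {p} {s} ps i with essential? s H (lookup candidates i)
  -- Candidates that are not essential, `G` itself among them, become a losing terminal option for
  -- `p`, which is sound and is not a check.
  ... | no ¬e = record
    { game     = terminal s
    ; conway   = inj₁ refl
    ; sound    = won (terminal-⊕ (⇄-sym ps) (nonTerminal≢ p (null-nonTerminalʳ G H null)))
    ; complete = λ e → ⊥-elim (¬e e)
    }
  ... | yes e with invertible-improvement ps null i (improves-wellFounded ps candidates i) e
  ... | E , F , E∈ , f , null′ , better with ih E∈ F null′
  ... | K , c , null″ = record
    { game     = K
    ; conway   = inj₂ c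
    -- `K` and `E` share the inverse `F`, so the win of `s` on E + H passes to K + H.
    ; sound    = cut-first K F H E (⇄-sym ps) (null″ s) (first-comm E H f) (null-comm E F null′ p)
    ; complete = λ _ W w → cut-second W E K F ps (better W w) (null″ p) (null′ s)
    }

  form : Game
  form = ⟨ (λ i → game (component 𝐋⇄𝐑 i)) ∣ (λ j → game (component 𝐑⇄𝐋 j)) ⟩

  option-component : ∀ {p s B} (ps : p ⇄ s) → B ∈[ p ] form → ∃ λ i → B ≡ game (component ps i)
  option-component 𝐋⇄𝐑 (left i)  = i , refl
  option-component 𝐑⇄𝐋 (right j) = j , refl

  component-option : ∀ {p s} (ps : p ⇄ s) i → game (component ps i) ∈[ p ] form
  component-option 𝐋⇄𝐑 i = left i
  component-option 𝐑⇄𝐋 j = right j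

  form-conway : ConwayForm form
  form-conway = conwayForm-intro nt λ {_} {s} ps m → let i , e = option-component ps m in
    subst (λ B → B ≡ terminal s ⊎ ConwayForm B) (sym e) (conway (component ps i))

  form-sound : ∀ {p s B} → p ⇄ s → B ∈[ p ] form → First s (B ⊕ H)
  form-sound {s = s} ps m = let i , e = option-component ps m in
    subst (λ B → First s (B ⊕ H)) (sym e) (sound (component ps i))

  form-complete : ∀ {p s E} → p ⇄ s → E ∈ properFollowers G → Essential s H E →
                  ∀ W → Second p (W ⊕ E) → ∃ λ B → B ∈[ p ] form × Second p (W ⊕ B)
  form-complete {p} {s} {E} ps E∈ e W d = _ , component-option ps i ,
    complete (component ps i) (subst (Essential s H) E≡ e) W (subst (λ X → Second p (W ⊕ X)) E≡ d)
    where
    i : Fin (length candidates)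
    i = index (there {x = G} E∈)
    E≡ : E ≡ lookup candidates i
    E≡ = lookup-index (there {x = G} E∈)

  form-null : Null (form ⊕ H)
  form-null = null-preserved {G} null nt form-sound form-complete

conway-inverse : ∀ G → HasConwayInverses G
conway-inverse = follower-induction HasConwayInverses λ G ih H null →
  let open ConwayInverse G H null ih in form , form-conway , form-null

-- Conjugates and mirroring.

neg-terminal : ∀ {p s} → p ⇄ s → - terminal p ≡ terminal s
neg-terminal 𝐋⇄𝐑 = refl
neg-terminal 𝐑⇄𝐋 = refl

neg-nonTerminal : ∀ {A} → NonTerminal A → NonTerminal (- A)
neg-nonTerminal {∞} a = ⊥-elim (proj₁ a refl)
neg-nonTerminal {∞̄} a = ⊥-elim (proj₂ a refl)
neg-nonTerminal {⟨ _ ∣ _ ⟩} a = nt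

neg-option : ∀ {p s A B} → p ⇄ s → B ∈[ p ] A → - B ∈[ s ] - A
neg-option 𝐋⇄𝐑 (left i)  = right i
neg-option 𝐑⇄𝐋 (right j) = left j

neg-option⁻ : ∀ {p s C} A → p ⇄ s → C ∈[ s ] - A → ∃ λ B → B ∈[ p ] A × C ≡ - B
neg-option⁻ ∞ _ ()
neg-option⁻ ∞̄ _ ()
neg-option⁻ ⟨ _ ∣ _ ⟩ 𝐋⇄𝐑 (right i) = _ , left i , refl
neg-option⁻ ⟨ _ ∣ _ ⟩ 𝐑⇄𝐋 (left j)  = _ , right j , refl

conway-null : ∀ {K} → ConwayForm K → Null (K ⊕ - K)
conway-null {K} c p = go (◁-wellFounded K) c
  where
  go : ∀ {p K} → Acc _◁_ K → ConwayForm K → Second p (K ⊕ - K)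
  go {p} {K} (acc rs) c@(k , _) = reply (⊕-nonTerminal k (neg-nonTerminal k)) λ {s} ps →
    ⊕-option-elim (First p) (moved ps) (λ m → let _ , m′ , e = neg-option⁻ K ps m in
      subst (λ C → First p (K ⊕ C)) (sym e) (mirrored ps m′))
    where
    moved : ∀ {s A} → p ⇄ s → A ∈[ s ] K → First p (A ⊕ - K)
    moved {s} ps m with conwayForm-option (⇄-sym ps) c m
    -- In the absence of checks, a terminal option reached by `s` is a win for `p`. Any other option
    -- is mirrored in the conjugate.
    ... | inj₁ refl     = won (terminal-⊕ ps (nonTerminal≢ s (neg-nonTerminal k)))
    ... | inj₂ c′@(a , _) = move (option-⊕ʳ a (neg-option (⇄-sym ps) m)) (go (rs (_ , m)) c′)
    mirrored : ∀ {s A} → p ⇄ s → A ∈[ p ] K → First p (K ⊕ - A)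
    mirrored {s} ps m with conwayForm-option ps c m
    ... | inj₁ refl = won (trans (cong (K ⊕_) (neg-terminal (⇄-sym ps))) (⊕-terminal ps (nonTerminal≢ s k)))
    ... | inj₂ c′@(a , _) = move (option-⊕ˡ (neg-nonTerminal a) m) (go (rs (_ , m)) c′)

mutual
  -- B + (-A) is A + (-B) with the roles of the players exchanged. One of `A` and `B` must be
  -- non-terminal, because the value `∞̄` chosen for the undefined sum is not symmetric under
  -- conjugation.
  first-conjugate : ∀ {p s A B} → p ⇄ s → Acc _◁_ A → Acc _◁_ B → NonTerminal A ⊎ NonTerminal B →
                    First p (A ⊕ - B) → First s (B ⊕ - A)
  first-conjugate {p} {s} {A} {B} ps accA accB (inj₁ a) f with view ps B
  ... | mine = ⊥-elim (¬first-terminal ps (subst (First p)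
          (trans (cong (A ⊕_) (neg-terminal ps)) (⊕-terminal (⇄-sym ps) (nonTerminal≢ p a))) f))
  ... | theirs = won (terminal-⊕ (⇄-sym ps) (nonTerminal≢ p (neg-nonTerminal a)))
  ... | neither b = first-conjugate-nonTerminal ps accA accB a b f
  first-conjugate {p} {s} {A} {B} ps accA accB (inj₂ b) f with view ps A
  ... | mine = won (trans (cong (B ⊕_) (neg-terminal ps)) (⊕-terminal (⇄-sym ps) (nonTerminal≢ p b)))
  ... | theirs = ⊥-elim (¬first-terminal ps (subst (First p)
          (terminal-⊕ (⇄-sym ps) (nonTerminal≢ p (neg-nonTerminal b))) f))
  ... | neither a = first-conjugate-nonTerminal ps accA accB a b f

  first-conjugate-nonTerminal : ∀ {p s A B} → p ⇄ s → Acc _◁_ A → Acc _◁_ B →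
                                NonTerminal A → NonTerminal B →
                                First p (A ⊕ - B) → First s (B ⊕ - A)
  first-conjugate-nonTerminal {A = A} {B} ps (acc rsA) (acc rsB) a b f
    with winning-option (⊕-nonTerminal a (neg-nonTerminal b)) f
  ... | _ , m , d with ⊕-option A (- B) m
  ... | inˡ {A′} l =
    move (option-⊕ʳ b (neg-option ps l)) (second-conjugate ps (rsA (_ , l)) (acc rsB) (inj₂ b) d)
  ... | inʳ l with neg-option⁻ B (⇄-sym ps) l
  ... | B′ , l′ , refl =
    move (option-⊕ˡ (neg-nonTerminal a) l′) (second-conjugate ps (acc rsA) (rsB (_ , l′)) (inj₁ a) d)

  second-conjugate : ∀ {p s A B} → p ⇄ s → Acc _◁_ A → Acc _◁_ B → NonTerminal A ⊎ NonTerminal B →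
                     Second p (A ⊕ - B) → Second s (B ⊕ - A)
  -- Determinacy reduces this to `first-conjugate` with `A` and `B` exchanged.
  second-conjugate {A = A} {B} ps accA accB ab d with first-or-second ps (B ⊕ - A)
  ... | inj₁ f = ⊥-elim (first-second-exclusive (⇄-sym ps) (first-conjugate ps accB accA (swap ab) f) d)
  ... | inj₂ e = e

null-conjugate : ∀ A B → NonTerminal A → Null (A ⊕ - B) → Null (B ⊕ - A)
null-conjugate A B a null s = let p , sp = opponent s in
  second-conjugate (⇄-sym sp) (◁-wellFounded A) (◁-wellFounded B) (inj₁ a) (null p)

-- Null games and equality of games.

null-𝟘 : Null 𝟘
null-𝟘 p = reply nt λ where
  𝐋⇄𝐑 (right _) → won refl
  𝐑⇄𝐋 (left _)  → won refl

winner-null-⊕ : ∀ {A} → Null A → ∀ X q → winner q X ≡ winner q (A ⊕ X)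
winner-null-⊕ null X = winner-unique
  (λ {p} → second+first (proj₂ (opponent p)) (null p))
  (λ {p} → second+second (proj₂ (opponent p)) (null p))

-- Adding B + H to A + X and cancelling A + H leaves B + X.
winner-same-inverse : ∀ A B H → Null (A ⊕ H) → Null (B ⊕ H) →
                      ∀ X q → winner q (A ⊕ X) ≡ winner q (B ⊕ X)
winner-same-inverse A B H nullA nullB X = winner-unique
  (λ {p} f → let s , ps = opponent p in
    cut-first B H X A ps (nullB p) (first-comm A X f) (null-comm A H nullA s))
  (λ {p} d → let s , ps = opponent p in
    cut-second B H X A ps (nullB p) (second-comm A X d) (null-comm A H nullA s))

null-resp-winner : ∀ {A B} → (∀ q → winner q A ≡ winner q B) → Null B → Null A
null-resp-winner e null p = let s , ps = opponent p in
  winner⇒second ps (trans (e s) (second⇒winner ps (null p)))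

≐-intro : ∀ A B → (∀ X q → winner q (A ⊕ X) ≡ winner q (B ⊕ X)) → A ≐ B
≐-intro A B e X x
  rewrite +≡⊕ A X (summableʳ A x) | +≡⊕ B X (summableʳ B x) = cong₂ _,_ (e X 𝐋) (e X 𝐑)

≐-elim : ∀ A B {X} → A ≐ B → NonTerminal X → ∀ q → winner q (A ⊕ X) ≡ winner q (B ⊕ X)
≐-elim A B {X} e x q with e X x
... | e′ rewrite +≡⊕ A X (summableʳ A x) | +≡⊕ B X (summableʳ B x) with q
... | 𝐋 = cong proj₁ e′
... | 𝐑 = cong proj₂ e′

null⇒≐𝟘 : ∀ {A} → Null A → A ≐ 𝟘
null⇒≐𝟘 {A} null = ≐-intro A 𝟘 λ X q → trans (sym (winner-null-⊕ null X q)) (winner-null-⊕ null-𝟘 X q)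

-- The test game is `𝟘`: A + 0 has the outcome of 0 + 0, and the added `𝟘` cancels.
≐𝟘⇒null : ∀ A → A ≐ 𝟘 → Null A
≐𝟘⇒null A e p = let s , ps = opponent p in
  cancel-second ps (null-𝟘 s) (second-comm A 𝟘
    (null-resp-winner (≐-elim A 𝟘 e nt)
      (λ p → second+second (proj₂ (opponent p)) (null-𝟘 p) (null-𝟘 p)) p))

-- Mirroring applies only to the form `K`. Testing G = K against -K gives G + (-K) = 0; conjugation
-- turns this into K + (-G) = 0, and testing against -G replaces the remaining `K` by `G`.
conwayGame-null : ∀ G → ConwayGame G → Null (G ⊕ - G)
conwayGame-null G (K , c@(k , _) , G≐K) =
  null-resp-winner (≐-elim G K G≐K (neg-nonTerminal g)) (null-conjugate G K g G-K-null)
  where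
  G-K-null : Null (G ⊕ - K)
  G-K-null = null-resp-winner (≐-elim G K G≐K (neg-nonTerminal k)) (conway-null c)
  g : NonTerminal G
  g = null-nonTerminalˡ G (- K) G-K-null

theorem48 : (G : Game) →
    (Invertible G ⇔ ConwayGame G) ×
    (ConwayGame G → Σ[ d ∈ Summable G (- G) ] G + (- G) [ d ] ≐ 𝟘)
theorem48 G = mk⇔ invertible⇒conway (λ c → - G , conway⇒inverse c) , conway⇒inverse
  where
  invertible⇒conway : Invertible G → ConwayGame G
  invertible⇒conway (H , d , e) =
    let null = subst Null (+≡⊕ G H d) (≐𝟘⇒null (G + H [ d ]) e)
        K , c , null′ = conway-inverse G H null
    in K , c , ≐-intro G K (winner-same-inverse G K H null null′)

  conway⇒inverse : ConwayGame G → Σ[ d ∈ Summable G (- G) ] G + (- G) [ d ] ≐ 𝟘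
  conway⇒inverse c =
    let null = conwayGame-null G c
        d    = summableˡ (- G) (null-nonTerminalˡ G (- G) null)
    in d , null⇒≐𝟘 (subst Null (sym (+≡⊕ G (- G) d)) null)
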